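{- There is a polynomial $p$ such that for every instance $E=(U,C)$ of 3SAT, the algorithm (Part A and Part B) run on $E$ uses space at most $p(|U|)$ bits; that is, the space complexity of the algorithm is polynomial in the size of the variable set $U$.
   Context: An instance of 3SAT is $E=(U,C)$ with $U$ a finite set of variables taking values in $\{T,F\}$ and $C$ a finite set of disjunctive clauses $\omega_1\vee\omega_2\vee\omega_3$, each $\omega_i$ being $u$ or $\neg u$ for some $u\in U$ (variables may repeat within a clause). $\mathrm{varset}(c)$ is the set of variables occurring in the clause $c$. Clausal partition $D$ of $C$: the partition of $C$ in which two clauses lie in the same element iff they have the same set of variables (ignoring negation). For $d\in D$, $\mathrm{varset}(d)$ is this common set of variables (at most 3 variables). Instance graph $G=(V,\beta)$: $V$ is in bijection with $D$ (identify vertices with elements of $D$), and $\{d_i,d_j\}\in\beta$ iff $d_i\ne d_j$ and $0<|\mathrm{varset}(d_i)\cap\mathrm{varset}(d_j)|<3$. Each $d\in D$ carries a constraint set $R(d)\subseteq\{T,F\}^{\mathrm{varset}(d)}$ of excluded assignments; the assignments not in $R(d)$ are the admissible assignments of $d$. Implication operator $d_i\nabla d_j$ (defined when $W=\mathrm{varset}(d_i)\cap\mathrm{varset}(d_j)\neq\emptyset$): an assignment $w:W\to\{T,F\}$ is inadmissible in $d_i$ if every extension of $w$ to $\mathrm{varset}(d_i)$ belongs to $R(d_i)$; the operator adds to $R(d_j)$ every assignment to $\mathrm{varset}(d_j)$ whose restriction to $W$ is inadmissible in $d_i$, and changes nothing else. Part A: initially $R(d)$ is the set of assignments to $\mathrm{varset}(d)$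 that fail at least one clause of $d$. Then repeat the following pass until a pass changes no constraint set (steady state): for every $d_i\in D$ and every $d_j$ adjacent to $d_i$ in $G$, apply $d_i\nabla d_j$. Part A then reports whether every $d\in D$ has a nonempty set of admissible assignments. Part B (run when Part A reports yes): for each vertex $d$ of $G$ in turn, select one admissible assignment of $d$, add all other assignments to $R(d)$, and repeat passes as in Part A until a steady state is attained. The data held by the algorithm are: a representation of $U$, the graph $G$, and, for each $d\in D$, the set of clauses of $d$ and the constraint set $R(d)$. -}

module Defs where

open import Data.Bool using (Bool; true; false)
import Data.Bool.Properties as Bool
open import Data.Fin using (Fin; _<?_; toℕ)
import Data.Fin.Properties as Fin
open import Data.Fin.Subset using (Subset; inside; outside; _∩_; ⋃; ⁅_⁆; ∣_∣; _⊆_)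
  renaming (_∈_ to _∈ˢ_)
open import Data.Fin.Subset.Properties using (p∩q⊆p; p∩q⊆q)
  renaming (_∈?_ to _∈ˢ?_)
open import Data.List as List using (List; []; _∷_; _++_)
open import Data.List.Properties using (++-assoc; ∷-injective; ∷-injectiveʳ)
import Data.List.Membership.DecPropositional as DecMembership
open import Data.List.Membership.Propositional using (_∈_; _∉_)
import Data.List.Relation.Unary.Any as Any
open import Data.List.Relation.Binary.Permutation.Propositional using (_↭_)
open import Data.List.Relation.Unary.Unique.Propositional using (Unique)
open import Data.Nat using (ℕ; _+_; _*_; _<_)
open import Data.Nat.Properties using () renaming (_<?_ to _<ℕ?_)
open import Data.Nat.Binary using (ℕᵇ; zero; 2[1+_]; 1+[2_]; fromℕ)
open import Data.Nat.Binary.Properties using (fromℕ-injective)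
open import Data.Product using (Σ; ∃; _×_; _,_; proj₁; proj₂; swap)
open import Data.Unit using (⊤; tt)
open import Data.Vec as Vec using (Vec; []; _∷_; here; there)
import Data.Vec.Properties as Vec
open import Data.Vec.Relation.Unary.Any as VecAny using ()
open import Function using (_∘_)
open import Relation.Binary.Definitions using (DecidableEquality)
open import Relation.Binary.PropositionalEquality
  using (_≡_; _≢_; refl; sym; trans; cong)
open import Relation.Nullary using (¬_; Dec; yes; no)
open import Relation.Nullary.Decidable as Dec using (_×-dec_; _→-dec_; ¬?)
open import Relation.Unary using (Pred; Decidable)
open import Level using (0ℓ)

private variable
  n m : ℕ
  V W : Subset n

------------------------------------------------------------------------
-- 3SAT.  The set of variables is Fin n.

-- (u , true) is the literal u and (u , false) is ¬ u.
Literal : ℕ → Set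
Literal n = Fin n × Bool

Clause : ℕ → Set
Clause n = Vec (Literal n) 3

record Instance (n : ℕ) : Set where
  field
    clauses  : List (Clause n)
    distinct : Unique clauses

open Instance public

varset : Clause n → Subset n
varset c = ⋃ (Vec.toList (Vec.map (⁅_⁆ ∘ proj₁) c))

_≟ˢ_ : DecidableEquality (Subset n)
_≟ˢ_ = Vec.≡-dec Bool._≟_

------------------------------------------------------------------------
-- Assignments to a set W of variables, i.e. elements of {T,F}^W

-- One Boolean for each member of W and nothing for the other variables,
-- so that propositional equality is equality of functions W → {T,F}.
data Assignment : Subset n → Set where
  []   : Assignment []
  skip : Assignment W → Assignment (outside ∷ W)
  _∷_  : Bool → Assignment W → Assignment (inside ∷ W)

value : Assignment W → ∀ {u} → u ∈ˢ W → Bool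
value (b ∷ a)  here      = b
value (b ∷ a)  (there p) = value a p
value (skip a) (there p) = value a p

value-irrelevant : ∀ (a : Assignment W) {u} (p q : u ∈ˢ W) → value a p ≡ value a q
value-irrelevant (b ∷ a)  here      here      = refl
value-irrelevant (b ∷ a)  (there p) (there q) = value-irrelevant a p q
value-irrelevant (skip a) (there p) (there q) = value-irrelevant a p q

tabulate : ∀ (W : Subset n) → (∀ {u} → u ∈ˢ W → Bool) → Assignment W
tabulate []            f = []
tabulate (outside ∷ W) f = skip (tabulate W (f ∘ there))
tabulate (inside ∷ W)  f = f here ∷ tabulate W (f ∘ there)

restrict : W ⊆ V → Assignment V → Assignment W
restrict {W = W} W⊆V a = tabulate W (λ u∈W → value a (W⊆V u∈W))

assignments : ∀ (W : Subset n) → List (Assignment W)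
assignments []            = [] ∷ []
assignments (outside ∷ W) = List.map skip (assignments W)
assignments (inside ∷ W)  =
  List.map (true ∷_) (assignments W) ++ List.map (false ∷_) (assignments W)

_≟ᵃ_ : DecidableEquality (Assignment W)
[]      ≟ᵃ []      = yes refl
skip a  ≟ᵃ skip b  = Dec.map′ (cong skip) (λ { refl → refl }) (a ≟ᵃ b)
(x ∷ a) ≟ᵃ (y ∷ b) =
  Dec.map′ (λ { (refl , refl) → refl }) (λ { refl → refl , refl })
    ((x Bool.≟ y) ×-dec (a ≟ᵃ b))

_∈?_ : (a : Assignment W) (R : List (Assignment W)) → Dec (a ∈ R)
_∈?_ = DecMembership._∈?_ _≟ᵃ_

all? : ∀ (W : Subset n) {P : Pred (Assignment W) 0ℓ} →
       Decidable P → Dec (∀ a → P a)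
all? []            P? = Dec.map′ (λ { p [] → p }) (λ f → f []) (P? [])
all? (outside ∷ W) P? =
  Dec.map′ (λ { f (skip a) → f a }) (λ f a → f (skip a)) (all? W (P? ∘ skip))
all? (inside ∷ W)  P? =
  Dec.map′ (λ { (f , g) (true ∷ a) → f a ; (f , g) (false ∷ a) → g a })
           (λ f → (λ a → f (true ∷ a)) , (λ a → f (false ∷ a)))
           (all? W (P? ∘ (true ∷_)) ×-dec all? W (P? ∘ (false ∷_)))

_⊨ˡ_ : {W : Subset n} → Assignment W → Literal n → Set
_⊨ˡ_ {W = W} a (u , s) = Σ (u ∈ˢ W) λ p → value a p ≡ s

_⊨_ : {W : Subset n} → Assignment W → Clause n → Set
a ⊨ c = VecAny.Any (a ⊨ˡ_) c

_⊨ˡ?_ : {W : Subset n} (a : Assignment W) (ω : Literal n) → Dec (a ⊨ˡ ω)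
_⊨ˡ?_ {W = W} a (u , s) with u ∈ˢ? W
... | no u∉W = no (u∉W ∘ proj₁)
... | yes p  = Dec.map′ (p ,_)
  (λ { (q , eq) → trans (value-irrelevant a p q) eq })
  (value a p Bool.≟ s)

_⊨?_ : {W : Subset n} (a : Assignment W) (c : Clause n) → Dec (a ⊨ c)
a ⊨? c = VecAny.any? (a ⊨ˡ?_) c

------------------------------------------------------------------------
-- Elements of the clausal partition, with their constraint sets R(d)

record Cell (n : ℕ) : Set where
  constructor cell
  field
    vars     : Subset n
    members  : List (Clause n)
    excluded : List (Assignment vars)

open Cell public

Admissible : (d : Cell n) → Pred (Assignment (vars d)) 0ℓ
Admissible d a = a ∉ excluded d

-- Every assignment satisfying P becomes excluded; those already excluded
-- are not stored a second time.
exclude : (d : Cell n) {P : Pred (Assignment (vars d)) 0ℓ} → Decidable P → Cell n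
exclude d P? = record d
  { excluded = excluded d ++
      List.filter (λ a → P? a ×-dec ¬? (a ∈? excluded d)) (assignments (vars d)) }

Inadmissible : (d : Cell n) → W ⊆ vars d → Pred (Assignment W) 0ℓ
Inadmissible d W⊆d w = ∀ a → restrict W⊆d a ≡ w → a ∈ excluded d

inadmissible? : (d : Cell n) (W⊆d : W ⊆ vars d) → Decidable (Inadmissible d W⊆d)
inadmissible? d W⊆d w =
  all? (vars d) (λ a → (restrict W⊆d a ≟ᵃ w) →-dec (a ∈? excluded d))

-- d ∇ e is e with the constraint set it has after the implication.
_∇_ : Cell n → Cell n → Cell n
d ∇ e = exclude e
  (inadmissible? d (p∩q⊆p (vars d) (vars e)) ∘ restrict (p∩q⊆q (vars d) (vars e)))

fix : (d : Cell n) → Assignment (vars d) → Cell n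
fix d a = exclude d (λ b → ¬? (b ≟ᵃ a))

------------------------------------------------------------------------
-- The data held by the algorithm

record Graph : Set where
  constructor graph
  field
    order : ℕ
    edges : List (Fin order × Fin order)   -- each edge once, one orientation

open Graph public

-- Both orientations of every edge.
arcs : (G : Graph) → List (Fin (order G) × Fin (order G))
arcs G = edges G ++ List.map swap (edges G)

record Memory (n : ℕ) : Set where
  constructor memory
  field
    variables     : List (Fin n)
    instanceGraph : Graph
    cells         : Vec (Cell n) (order instanceGraph)

open Memory public

Vertex : Memory n → Set
Vertex M = Fin (order (instanceGraph M))

cellOf : (M : Memory n) → Vertex M → Cell n
cellOf M = Vec.lookup (cells M)

setCell : (M : Memory n) → Vertex M → Cell n → Memory n
setCell M i d = record M { cells = cells M Vec.[ i ]≔ d }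

implication : (M : Memory n) → Vertex M → Vertex M → Memory n
implication M i j = setCell M j (cellOf M i ∇ cellOf M j)

------------------------------------------------------------------------
-- Initial data

initialCell : List (Clause n) → Subset n → Cell n
initialCell C W = record
  { vars     = W
  ; members  = d
  ; excluded = List.filter (λ a → Any.any? (λ c → ¬? (a ⊨? c)) d) (assignments W)
  }
  where d = List.filter (λ c → varset c ≟ˢ W) C

varsets : List (Clause n) → List (Subset n)
varsets C = List.deduplicate _≟ˢ_ (List.map varset C)

clausalPartition : (C : List (Clause n)) → Vec (Cell n) (List.length (varsets C))
clausalPartition C = Vec.map (initialCell C) (Vec.fromList (varsets C))

Overlap : Cell n → Cell n → Set
Overlap d e = 0 < ∣ vars d ∩ vars e ∣ × ∣ vars d ∩ vars e ∣ < 3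

overlap? : (d e : Cell n) → Dec (Overlap d e)
overlap? d e = (0 <ℕ? _) ×-dec (_ <ℕ? 3)

graphOf : Vec (Cell n) m → Graph
graphOf {m = m} D = record
  { order = m
  ; edges = List.filter
      (λ (i , j) → (i <? j) ×-dec overlap? (Vec.lookup D i) (Vec.lookup D j))
      (List.cartesianProduct (List.allFin m) (List.allFin m))
  }

initial : Instance n → Memory n
initial {n} E = record
  { variables     = List.allFin n
  ; instanceGraph = graphOf (clausalPartition (clauses E))
  ; cells         = clausalPartition (clauses E)
  }

------------------------------------------------------------------------
-- Execution, as a transition system.  The orders in which a pass visits
-- the adjacent pairs and in which Part B visits the vertices, as well as
-- the assignments selected in Part B, are left open.

-- In partB the list holds the vertices still to be treated.
data Phase (G : Graph) : Set where
  partA : Phase G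
  partB : List (Fin (order G)) → Phase G

data Control (G : Graph) : Set where
  newPass : Phase G → Control G
  -- Inside a pass: the pairs still to be treated, and whether the pass
  -- has changed a constraint set so far.
  inPass  : Phase G → List (Fin (order G) × Fin (order G)) → Bool → Control G
  select  : List (Fin (order G)) → Control G
  reject  : Control G

Config : ℕ → Set
Config n = Σ (Memory n) (Control ∘ instanceGraph)

start : Instance n → Config n
start E = initial E , newPass partA

infix 4 _⟶_

data _⟶_ {n : ℕ} : Config n → Config n → Set where

  begin-pass : ∀ {M φ todo} → todo ↭ arcs (instanceGraph M) →
    (M , newPass φ) ⟶ (M , inPass φ todo false)

  -- Constraint sets only ever grow at the end of their lists, so equality
  -- of memories is equality of all constraint sets.
  unchanged : ∀ {M φ i j todo b} → implication M i j ≡ M →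
    (M , inPass φ ((i , j) ∷ todo) b) ⟶ (M , inPass φ todo b)

  changed : ∀ {M φ i j todo b} → implication M i j ≢ M →
    (M , inPass φ ((i , j) ∷ todo) b) ⟶ (implication M i j , inPass φ todo true)

  repeat-pass : ∀ {M φ} →
    (M , inPass φ [] true) ⟶ (M , newPass φ)

  partA-yes : ∀ {M todo} →
    (∀ i → ∃ (Admissible (cellOf M i))) →
    todo ↭ List.allFin (order (instanceGraph M)) →
    (M , inPass partA [] false) ⟶ (M , select todo)

  partA-no : ∀ {M} →
    ¬ (∀ i → ∃ (Admissible (cellOf M i))) →
    (M , inPass partA [] false) ⟶ (M , reject)

  choose : ∀ {M i todo a} → Admissible (cellOf M i) a →
    (M , select (i ∷ todo)) ⟶ (setCell M i (fix (cellOf M i) a) , newPass (partB todo))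

  partB-steady : ∀ {M todo} →
    (M , inPass (partB todo) [] false) ⟶ (M , select todo)

------------------------------------------------------------------------
-- Binary representation of the data

-- A uniquely decodable binary code.
record Code (A : Set) : Set where
  field
    encode    : A → List Bool
    decodable : ∀ x y {r s} → encode x ++ r ≡ encode y ++ s → x ≡ y × r ≡ s

open Code public

via : {A B : Set} (f : A → B) → (∀ {x y} → f x ≡ f y → x ≡ y) → Code B → Code A
via f inj B .encode x = encode B (f x)
via f inj B .decodable x y eq with decodable B (f x) (f y) eq
... | fx≡fy , r≡s = inj fx≡fy , r≡s

unitCode : Code ⊤
unitCode .encode _ = []
unitCode .decodable _ _ eq = refl , eq

boolCode : Code Bool
boolCode .encode b = b ∷ []
boolCode .decodable _ _ eq = ∷-injective eq

Σ-code : {A : Set} {B : A → Set} → Code A → (∀ a → Code (B a)) → Code (Σ A B)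
Σ-code A B .encode (a , b) = encode A a ++ encode (B a) b
Σ-code A B .decodable (a , b) (a′ , b′) eq
  with decodable A a a′ (trans (sym (++-assoc (encode A a) _ _))
                          (trans eq (++-assoc (encode A a′) _ _)))
... | refl , eq′ with decodable (B a) b b′ eq′
... | refl , r≡s = refl , r≡s

_×-code_ : {A B : Set} → Code A → Code B → Code (A × B)
A ×-code B = Σ-code A (λ _ → B)

vecCode : {A : Set} → Code A → ∀ n → Code (Vec A n)
vecCode A ℕ.zero    = via (λ _ → tt) (λ { {[]} {[]} _ → refl }) unitCode
vecCode A (ℕ.suc n) =
  via (λ { (x ∷ xs) → x , xs }) (λ { {_ ∷ _} {_ ∷ _} refl → refl })
    (A ×-code vecCode A n)

encodeList : {A : Set} → Code A → List A → List Bool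
encodeList A []       = false ∷ []
encodeList A (x ∷ xs) = true ∷ encode A x ++ encodeList A xs

decodableList : {A : Set} (A-code : Code A) (xs ys : List A) {r s : List Bool} →
  encodeList A-code xs ++ r ≡ encodeList A-code ys ++ s → xs ≡ ys × r ≡ s
decodableList A []       []       eq = refl , ∷-injectiveʳ eq
decodableList A []       (_ ∷ _)  ()
decodableList A (_ ∷ _)  []       ()
decodableList A (x ∷ xs) (y ∷ ys) eq
  with decodable A x y (trans (sym (++-assoc (encode A x) _ _))
                         (trans (∷-injectiveʳ eq) (++-assoc (encode A y) _ _)))
... | refl , eq′ with decodableList A xs ys eq′
... | refl , r≡s = refl , r≡s

listCode : {A : Set} → Code A → Code (List A)
listCode A .encode    = encodeList A
listCode A .decodable = decodableList A

ℕᵇ-code : Code ℕᵇ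
ℕᵇ-code .encode zero     = false ∷ []
ℕᵇ-code .encode 2[1+ x ] = true ∷ false ∷ encode ℕᵇ-code x
ℕᵇ-code .encode 1+[2 x ] = true ∷ true ∷ encode ℕᵇ-code x
ℕᵇ-code .decodable zero     zero     eq = refl , ∷-injectiveʳ eq
ℕᵇ-code .decodable zero     2[1+ _ ] ()
ℕᵇ-code .decodable zero     1+[2 _ ] ()
ℕᵇ-code .decodable 2[1+ _ ] zero     ()
ℕᵇ-code .decodable 1+[2 _ ] zero     ()
ℕᵇ-code .decodable 2[1+ _ ] 1+[2 _ ] ()
ℕᵇ-code .decodable 1+[2 _ ] 2[1+ _ ] ()
ℕᵇ-code .decodable 2[1+ x ] 2[1+ y ] eq
  with decodable ℕᵇ-code x y (∷-injectiveʳ (∷-injectiveʳ eq))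
... | refl , r≡s = refl , r≡s
ℕᵇ-code .decodable 1+[2 x ] 1+[2 y ] eq
  with decodable ℕᵇ-code x y (∷-injectiveʳ (∷-injectiveʳ eq))
... | refl , r≡s = refl , r≡s

ℕ-code : Code ℕ
ℕ-code = via fromℕ fromℕ-injective ℕᵇ-code

finCode : ∀ n → Code (Fin n)
finCode n = via toℕ Fin.toℕ-injective ℕ-code

assignmentCode : ∀ (W : Subset n) → Code (Assignment W)
assignmentCode []            = via (λ _ → tt) (λ { {[]} {[]} _ → refl }) unitCode
assignmentCode (outside ∷ W) =
  via (λ { (skip a) → a }) (λ { {skip _} {skip _} refl → refl }) (assignmentCode W)
assignmentCode (inside ∷ W)  =
  via (λ { (b ∷ a) → b , a }) (λ { {_ ∷ _} {_ ∷ _} refl → refl })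
    (boolCode ×-code assignmentCode W)

clauseCode : ∀ n → Code (Clause n)
clauseCode n = vecCode (finCode n ×-code boolCode) 3

cellCode : ∀ n → Code (Cell n)
cellCode n =
  via (λ d → vars d , members d , excluded d) (λ { {cell _ _ _} {cell _ _ _} refl → refl })
    (Σ-code (vecCode boolCode n) λ W →
      listCode (clauseCode n) ×-code listCode (assignmentCode W))

graphCode : Code Graph
graphCode =
  via (λ G → order G , edges G) (λ { {graph _ _} {graph _ _} refl → refl })
    (Σ-code ℕ-code λ m → listCode (finCode m ×-code finCode m))

memoryCode : ∀ n → Code (Memory n)
memoryCode n =
  via (λ M → variables M , instanceGraph M , cells M)
      (λ { {memory _ _ _} {memory _ _ _} refl → refl })
    (listCode (finCode n) ×-code Σ-code graphCode λ G → vecCode (cellCode n) (order G))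

bits : Memory n → ℕ
bits {n} M = List.length (encode (memoryCode n) M)

------------------------------------------------------------------------
-- Polynomials, as lists of coefficients in order of increasing degree

eval : List ℕ → ℕ → ℕ
eval p x = List.foldr (λ a r → a + x * r) 0 p

{-# OPTIONS --safe #-}
module Submission where

-- The clauses are distinct, so there are at most (2n)³ of them, and hence at
-- most that many cells.  The execution leaves everything but the constraint
-- sets alone, and it never stores an excluded assignment twice.  A cell has at
-- most 3 variables, so its constraint set has at most 2³ elements throughout.

open import Defs
open import Data.Bool using (Bool; true; false)
open import Data.Fin as Fin using (Fin; toℕ)
import Data.Fin.Properties as Fin
open import Data.Fin.Subset using (Subset; inside; outside; ⁅_⁆; _∪_; ∣_∣)
open import Data.Fin.Subset.Properties using (∣⊥∣≡0; ∣⁅x⁆∣≡1; p∩q⊆p; p∩q⊆q)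
open import Data.List as List using (List; []; _∷_; _++_; length)
open import Data.List.Membership.Propositional using (_∈_)
open import Data.List.Membership.Propositional.Properties
  using (∈-lookup; ∈-map⁻; ∈-deduplicate⁻; ∈-filter⁻)
open import Data.List.Properties
  using (length-++; length-map; length-filter; length-deduplicate; length-tabulate)
import Data.List.Relation.Unary.All as ListAll
import Data.List.Relation.Unary.AllPairs as AllPairs
open import Data.List.Relation.Unary.Unique.Propositional using (Unique)
import Data.List.Relation.Unary.Unique.Propositional.Properties as Unique
open import Data.Nat using (ℕ; zero; suc; _+_; _*_; _^_; _≤_; z≤n; s≤s)
open import Data.Nat.Binary as ℕᵇ using (2[1+_]; 1+[2_])
import Data.Nat.Binary.Properties as ℕᵇ
open import Data.Nat.Properties
open import Data.Nat.Tactic.RingSolver using (solve-∀)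
open import Data.Product using (∃; _×_; _,_; proj₁; proj₂)
open import Data.Product.Function.NonDependent.Propositional using (_×-↣_)
open import Data.Vec as Vec using (Vec; []; _∷_)
import Data.Vec.Properties as Vec
import Data.Vec.Relation.Unary.All.Properties as All
open import Function using (_∘_; id; _↣_; mk↣; Injection)
open import Function.Construct.Composition using (_↣-∘_)
open import Function.Construct.Identity using (↣-id)
open import Function.Construct.Symmetry using (↔-sym)
open import Function.Properties.Inverse using (↔⇒↣)
open import Relation.Binary.Construct.Closure.ReflexiveTransitive using (Star; ε; _◅_)
open import Relation.Binary.PropositionalEquality
  using (_≡_; refl; sym; cong; subst)
open import Relation.Nullary using (¬_; yes; no; contradiction)
open import Relation.Nullary.Decidable using (_×-dec_; ¬?)
open import Relation.Unary using (Pred; Decidable)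
open import Level using (0ℓ)

private variable
  A : Set
  b k m n : ℕ

-- Lists without repetition and injections into finite sets

lookup-injective : {xs : List A} → Unique xs →
  ∀ {i j} → List.lookup xs i ≡ List.lookup xs j → i ≡ j
lookup-injective {xs = _ ∷ _} _ {Fin.zero} {Fin.zero} _ = refl
lookup-injective {xs = _ ∷ _} (x∉xs AllPairs.∷ _) {Fin.zero} {Fin.suc j} eq =
  contradiction eq (ListAll.lookup x∉xs (∈-lookup j))
lookup-injective {xs = _ ∷ _} (x∉xs AllPairs.∷ _) {Fin.suc i} {Fin.zero} eq =
  contradiction (sym eq) (ListAll.lookup x∉xs (∈-lookup i))
lookup-injective {xs = _ ∷ _} (_ AllPairs.∷ xs!) {Fin.suc i} {Fin.suc j} eq =
  cong Fin.suc (lookup-injective xs! eq)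

-- Pigeonhole: lookup followed by `f` injects the positions of `xs` into `Fin k`.
unique⇒length≤ : A ↣ Fin k → {xs : List A} → Unique xs → length xs ≤ k
unique⇒length≤ f xs! =
  Fin.injective⇒≤ (lookup-injective xs! ∘ Injection.injective f)

Fin×Fin↣Fin : (Fin m × Fin n) ↣ Fin (m * n)
Fin×Fin↣Fin = ↔⇒↣ (↔-sym Fin.*↔×)

Vec↣Fin : A ↣ Fin m → ∀ k → Vec A k ↣ Fin (m ^ k)
Vec↣Fin f zero    = mk↣ {to = λ _ → Fin.zero} λ { {[]} {[]} _ → refl }
Vec↣Fin f (suc k) =
  Fin×Fin↣Fin ↣-∘ ((f ×-↣ Vec↣Fin f k) ↣-∘
    mk↣ {to = Vec.uncons} λ { {_ ∷ _} {_ ∷ _} refl → refl })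

Bool↣Fin : Bool ↣ Fin 2
Bool↣Fin = ↔⇒↣ (↔-sym Fin.2↔Bool)

Literal↣Fin : Literal n ↣ Fin (n * 2)
Literal↣Fin = Fin×Fin↣Fin ↣-∘ (↣-id _ ×-↣ Bool↣Fin)

-- A `skip` contributes no factor, so the count depends on the size of `W` alone and stays constant
-- for cells of at most 3 variables.
Assignment↣Fin : (W : Subset n) → Assignment W ↣ Fin (2 ^ ∣ W ∣)
Assignment↣Fin []            = mk↣ {to = λ _ → Fin.zero} λ { {[]} {[]} _ → refl }
Assignment↣Fin (outside ∷ W) =
  Assignment↣Fin W ↣-∘ mk↣ {to = λ { (skip a) → a }} λ { {skip _} {skip _} refl → refl }
Assignment↣Fin (inside ∷ W)  =
  Fin×Fin↣Fin ↣-∘ ((Bool↣Fin ×-↣ Assignment↣Fin W) ↣-∘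
    mk↣ {to = λ { (x ∷ a) → x , a }} λ { {_ ∷ _} {_ ∷ _} refl → refl })

-- Constraint sets are assembled from filtered copies of this enumeration, so their freedom from
-- repetition starts here.
assignments-unique : (W : Subset n) → Unique (assignments W)
assignments-unique []            = ListAll.[] AllPairs.∷ AllPairs.[]
assignments-unique (outside ∷ W) =
  Unique.map⁺ (λ { refl → refl }) (assignments-unique W)
assignments-unique (inside ∷ W)  = Unique.++⁺
  (Unique.map⁺ (λ { refl → refl }) (assignments-unique W))
  (Unique.map⁺ (λ { refl → refl }) (assignments-unique W))
  λ (p , q) → disjoint (∈-map⁻ _ p) (∈-map⁻ _ q)
  where
  disjoint : ∀ {a} → ∃ (λ x → x ∈ assignments W × a ≡ true ∷ x) →
    ¬ ∃ (λ x → x ∈ assignments W × a ≡ false ∷ x)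
  disjoint (_ , _ , refl) (_ , _ , ())

-- Number of variables of a clause

∣p∪q∣≤∣p∣+∣q∣ : (p q : Subset n) → ∣ p ∪ q ∣ ≤ ∣ p ∣ + ∣ q ∣
∣p∪q∣≤∣p∣+∣q∣ []            []            = z≤n
∣p∪q∣≤∣p∣+∣q∣ (outside ∷ p) (outside ∷ q) = ∣p∪q∣≤∣p∣+∣q∣ p q
∣p∪q∣≤∣p∣+∣q∣ (outside ∷ p) (inside ∷ q)  =
  ≤-trans (s≤s (∣p∪q∣≤∣p∣+∣q∣ p q)) (≤-reflexive (sym (+-suc ∣ p ∣ ∣ q ∣)))
∣p∪q∣≤∣p∣+∣q∣ (inside ∷ p)  (outside ∷ q) = s≤s (∣p∪q∣≤∣p∣+∣q∣ p q)
∣p∪q∣≤∣p∣+∣q∣ (inside ∷ p)  (inside ∷ q)  =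
  s≤s (≤-trans (∣p∪q∣≤∣p∣+∣q∣ p q) (+-monoʳ-≤ ∣ p ∣ (n≤1+n ∣ q ∣)))

∣varset∣≤3 : (c : Clause n) → ∣ varset c ∣ ≤ 3
∣varset∣≤3 {n} ((u , _) ∷ (v , _) ∷ (w , _) ∷ []) =
  -- `⋃` folds from the empty set, of size 0, and each singleton adds at most 1; a repeated variable
  -- only lowers the size.
  add u (add v (add w (≤-reflexive (∣⊥∣≡0 n))))
  where
  add : ∀ x {p : Subset n} {k} → ∣ p ∣ ≤ k → ∣ ⁅ x ⁆ ∪ p ∣ ≤ suc k
  add x {p} p≤k = ≤-trans (∣p∪q∣≤∣p∣+∣q∣ ⁅ x ⁆ p)
    (+-mono-≤ (≤-reflexive (∣⁅x⁆∣≡1 x)) p≤k)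

-- The invariant and the initial memory

-- There are 2n literals.  Every cell contains a clause, so this also bounds
-- the number of cells.
maxClauses : ℕ → ℕ
maxClauses n = (n * 2) ^ 3

-- For `excluded`, distinctness is kept instead of a length bound: a length bound alone could break
-- when `exclude` appends, while distinctness survives and gives the bound by counting.
record SmallCell {n} (d : Cell n) : Set where
  field
    vars-small      : ∣ vars d ∣ ≤ 3
    members-small   : length (members d) ≤ maxClauses n
    excluded-unique : Unique (excluded d)

record SmallMemory {n} (M : Memory n) : Set where
  field
    variables-small : length (variables M) ≤ n
    order-small     : order (instanceGraph M) ≤ maxClauses n
    edges-unique    : Unique (edges (instanceGraph M))
    cells-small     : ∀ i → SmallCell (cellOf M i)

open SmallCell
open SmallMemory

clauses-small : (E : Instance n) → length (clauses E) ≤ maxClauses n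
clauses-small E = unique⇒length≤ (Vec↣Fin Literal↣Fin 3) (distinct E)

varsets-small : (C : List (Clause n)) → ∀ {W} → W ∈ varsets C → ∣ W ∣ ≤ 3
varsets-small C W∈ with ∈-map⁻ varset (∈-deduplicate⁻ _≟ˢ_ (List.map varset C) W∈)
... | c , _ , refl = ∣varset∣≤3 c

initial-small : (E : Instance n) → SmallMemory (initial E)
initial-small {n} E = record
  { variables-small = ≤-reflexive (length-tabulate {n = n} id)
  ; order-small     = ≤-trans (length-deduplicate _≟ˢ_ (List.map varset C))
      (≤-trans (≤-reflexive (length-map varset C)) (clauses-small E))
  ; edges-unique    =
      Unique.filter⁺ _ (Unique.cartesianProduct⁺ (Unique.allFin⁺ _) (Unique.allFin⁺ _))
  -- Only variable sets of actual clauses are known to be small, so membership in `varsets C` is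
  -- supplied to each entry.
  ; cells-small     = All.lookup⁺ {P = SmallCell}
      (All.map⁺ {f = initialCell C} (All.fromList⁺ (ListAll.tabulate cell-small)))
  }
  where
  C = clauses E
  cell-small : ∀ {W} → W ∈ varsets C → SmallCell (initialCell C W)
  cell-small {W} W∈ = record
    { vars-small      = varsets-small C W∈
    ; members-small   =
        ≤-trans (length-filter (λ c → varset c ≟ˢ W) C) (clauses-small E)
    ; excluded-unique = Unique.filter⁺ _ (assignments-unique W)
    }

-- Preservation of the invariant

exclude-small : {d : Cell n} {P : Pred (Assignment (vars d)) 0ℓ} (P? : Decidable P) →
  SmallCell d → SmallCell (exclude d P?)
exclude-small {d = d} P? s = record
  { vars-small      = vars-small s
  ; members-small   = members-small s
  ; excluded-unique = Unique.++⁺ (excluded-unique s)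
      (Unique.filter⁺ _ (assignments-unique (vars d)))
      -- The second conjunct of the filter in `exclude` makes the appended part disjoint from the
      -- old list.
      λ (old , new) → proj₂ (proj₂
        (∈-filter⁻ (λ a → P? a ×-dec ¬? (a ∈? excluded d)) {xs = assignments (vars d)} new)) old
  }

∇-small : (d : Cell n) {e : Cell n} → SmallCell e → SmallCell (d ∇ e)
∇-small d {e} = exclude-small
  (inadmissible? d (p∩q⊆p (vars d) (vars e)) ∘ restrict (p∩q⊆q (vars d) (vars e)))

fix-small : {d : Cell n} (a : Assignment (vars d)) → SmallCell d → SmallCell (fix d a)
fix-small a = exclude-small (λ b → ¬? (b ≟ᵃ a))

setCell-small : {M : Memory n} → SmallMemory M →
  ∀ i {d} → SmallCell d → SmallMemory (setCell M i d)
setCell-small {M = M} s i {d} d-small = record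
  { variables-small = variables-small s
  ; order-small     = order-small s
  ; edges-unique    = edges-unique s
  ; cells-small     = updated
  }
  where
  updated : ∀ j → SmallCell (cellOf (setCell M i d) j)
  updated j with i Fin.≟ j
  ... | yes refl = subst SmallCell (sym (Vec.lookup∘update i (cells M) d)) d-small
  ... | no i≢j   = subst SmallCell
    (sym (Vec.lookup∘update′ (i≢j ∘ sym) (cells M) d)) (cells-small s j)

-- Only `changed` and `choose` alter the memory, and each replaces one cell by its image under
-- `exclude`. The order of visits and the selected assignments do not matter.
⟶-small : {S T : Config n} → S ⟶ T → SmallMemory (proj₁ S) → SmallMemory (proj₁ T)
⟶-small (begin-pass _)   s = s
⟶-small (unchanged _)    s = s
⟶-small (changed {M = M} {i = i} {j = j} _) s =
  setCell-small s j (∇-small (cellOf M i) (cells-small s j))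
⟶-small repeat-pass      s = s
⟶-small (partA-yes _ _)  s = s
⟶-small (partA-no _)     s = s
⟶-small (choose {i = i} {a = a} _) s =
  setCell-small s i (fix-small a (cells-small s i))
⟶-small partB-steady     s = s

⟶*-small : {S T : Config n} → Star _⟶_ S T → SmallMemory (proj₁ S) → SmallMemory (proj₁ T)
⟶*-small ε        s = s
⟶*-small (r ◅ rs) s = ⟶*-small rs (⟶-small r s)

-- Lengths of the codes

length-++-≤ : (xs : List A) {ys : List A} →
  length xs ≤ k → length ys ≤ m → length (xs ++ ys) ≤ k + m
length-++-≤ xs xs≤k ys≤m = ≤-trans (≤-reflexive (length-++ xs)) (+-mono-≤ xs≤k ys≤m)

-- Each entry costs one flag bit besides its own code, and the terminator costs one more bit.
listCode-length : (code : Code A) → (∀ x → length (encode code x) ≤ b) →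
  ∀ xs → length xs ≤ k → length (encode (listCode code) xs) ≤ 1 + k * (1 + b)
listCode-length code ≤b []       _         = s≤s z≤n
listCode-length {b = b} code ≤b (x ∷ xs) (s≤s {n = k} xs≤k) = s≤s (begin
  length (encode code x ++ encode (listCode code) xs)
    ≤⟨ length-++-≤ (encode code x) (≤b x) (listCode-length code ≤b xs xs≤k) ⟩
  b + (1 + k * (1 + b))
    ≡⟨ +-suc b _ ⟩
  1 + b + k * (1 + b)
    ∎)
  where open ≤-Reasoning

-- The length is known from the type, so no delimiters are stored. The hypothesis is indexed to fit
-- `cells-small`.
vecCode-length : (code : Code A) (xs : Vec A n) →
  (∀ i → length (encode code (Vec.lookup xs i)) ≤ b) →
  length (encode (vecCode code n) xs) ≤ n * b
vecCode-length code []       ≤b = z≤n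
vecCode-length code (x ∷ xs) ≤b = length-++-≤ (encode code x) (≤b Fin.zero)
  (vecCode-length code xs (≤b ∘ Fin.suc))

-- The true length is logarithmic, but a linear bound suffices: a digit adds two bits and takes the
-- value from `t` to at least `1 + 2 * t`, which raises the bound by at least 2.
ℕᵇ-code-length : ∀ x → length (encode ℕᵇ-code x) ≤ 1 + 2 * ℕᵇ.toℕ x
ℕᵇ-code-length ℕᵇ.zero  = s≤s z≤n
ℕᵇ-code-length 2[1+ x ] = begin
  2 + length (encode ℕᵇ-code x)  ≤⟨ +-monoʳ-≤ 2 (ℕᵇ-code-length x) ⟩
  2 + (1 + 2 * t)                ≤⟨ m≤m+n _ (2 + 2 * t) ⟩
  2 + (1 + 2 * t) + (2 + 2 * t)  ≡⟨ identity t ⟩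
  1 + 2 * (2 * (1 + t))          ∎
  where
  open ≤-Reasoning
  t = ℕᵇ.toℕ x
  identity : ∀ t → 2 + (1 + 2 * t) + (2 + 2 * t) ≡ 1 + 2 * (2 * (1 + t))
  identity = solve-∀
ℕᵇ-code-length 1+[2 x ] = begin
  2 + length (encode ℕᵇ-code x)  ≤⟨ +-monoʳ-≤ 2 (ℕᵇ-code-length x) ⟩
  2 + (1 + 2 * t)                ≤⟨ m≤m+n _ (2 * t) ⟩
  2 + (1 + 2 * t) + 2 * t        ≡⟨ identity t ⟩
  1 + 2 * (1 + 2 * t)            ∎
  where
  open ≤-Reasoning
  t = ℕᵇ.toℕ x
  identity : ∀ t → 2 + (1 + 2 * t) + 2 * t ≡ 1 + 2 * (1 + 2 * t)
  identity = solve-∀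

ℕ-code-length : ∀ k → length (encode ℕ-code k) ≤ 1 + 2 * k
ℕ-code-length k = subst (λ j → length (encode ℕ-code k) ≤ 1 + 2 * j)
  (ℕᵇ.toℕ-fromℕ k) (ℕᵇ-code-length (ℕᵇ.fromℕ k))

finCode-length : n ≤ k → (i : Fin n) → length (encode (finCode n) i) ≤ 2 * k
finCode-length {n} {k} n≤k i = begin
  length (encode (finCode n) i)  ≤⟨ ℕ-code-length (toℕ i) ⟩
  -- One spare bit is added so that the sum becomes `2 * suc (toℕ i)`, where `toℕ i < n` applies.
  1 + 2 * toℕ i                  ≤⟨ n≤1+n _ ⟩
  2 + 2 * toℕ i                  ≡⟨ *-suc 2 (toℕ i) ⟨
  2 * suc (toℕ i)                ≤⟨ *-monoʳ-≤ 2 (≤-trans (Fin.toℕ<n i) n≤k) ⟩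
  2 * k                          ∎
  where open ≤-Reasoning

assignmentCode-length : {W : Subset n} (a : Assignment W) →
  length (encode (assignmentCode W) a) ≡ ∣ W ∣
assignmentCode-length []       = refl
assignmentCode-length (skip a) = assignmentCode-length a
assignmentCode-length (_ ∷ a)  = cong suc (assignmentCode-length a)

clauseCode-length : (c : Clause n) → length (encode (clauseCode n) c) ≤ 3 * (2 * n + 1)
clauseCode-length {n} c = vecCode-length (finCode n ×-code boolCode) c λ i →
  let u = proj₁ (Vec.lookup c i) in
  length-++-≤ (encode (finCode n) u) (finCode-length ≤-refl u) ≤-refl

-- Bounds for cells, graph and memory

-- The summands cover `vars`, `members` and `excluded`; the last allows 2³ assignments of 3 bits
-- each. The sum is left unsimplified to match the code length lemmas by computation.
cellBound : ℕ → ℕ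
cellBound n = n * 1 + ((1 + maxClauses n * (1 + 3 * (2 * n + 1))) + (1 + 8 * (1 + 3)))

cellCode-length : (d : Cell n) → SmallCell d → length (encode (cellCode n) d) ≤ cellBound n
cellCode-length {n} d s =
  length-++-≤ (encode (vecCode boolCode n) (vars d)) (vecCode-length _ (vars d) λ _ → ≤-refl)
    (length-++-≤ (encode (listCode (clauseCode n)) (members d))
      (listCode-length _ clauseCode-length (members d) (members-small s))
      (listCode-length _
        (λ a → ≤-trans (≤-reflexive (assignmentCode-length a)) (vars-small s))
        (excluded d)
        (≤-trans (unique⇒length≤ (Assignment↣Fin (vars d)) (excluded-unique s))
          (^-monoʳ-≤ 2 (vars-small s)))))

-- The first summand pays for the order; `N * N` counts the ordered pairs of vertices, among which
-- the edges are distinct.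
graphBound : ℕ → ℕ
graphBound N = (1 + 2 * N) + (1 + N * N * (1 + (2 * N + 2 * N)))

graphCode-length : (G : Graph) → order G ≤ k → Unique (edges G) →
  length (encode graphCode G) ≤ graphBound k
graphCode-length G m≤k edges! =
  length-++-≤ (encode ℕ-code (order G))
    (≤-trans (ℕ-code-length (order G)) (+-monoʳ-≤ 1 (*-monoʳ-≤ 2 m≤k)))
    (listCode-length _
      (λ (i , j) → length-++-≤ (encode (finCode (order G)) i)
        (finCode-length m≤k i) (finCode-length m≤k j))
      (edges G)
      (≤-trans (unique⇒length≤ Fin×Fin↣Fin edges!) (*-mono-≤ m≤k m≤k)))

memoryBound : ℕ → ℕ
memoryBound n =
  (1 + n * (1 + 2 * n)) + (graphBound (maxClauses n) + maxClauses n * cellBound n)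

bits≤memoryBound : (M : Memory n) → SmallMemory M → bits M ≤ memoryBound n
bits≤memoryBound {n} M s =
  length-++-≤ (encode (listCode (finCode n)) (variables M))
    (listCode-length _ (finCode-length ≤-refl) (variables M) (variables-small s))
    (length-++-≤ (encode graphCode (instanceGraph M))
      (graphCode-length (instanceGraph M) (order-small s) (edges-unique s))
      (≤-trans
        (vecCode-length _ (cells M) λ i → cellCode-length (cellOf M i) (cells-small s i))
        (*-monoˡ-≤ (cellBound n) (order-small s))))

-- The explicit polynomial

-- The expansion of `memoryBound n` with `maxClauses n` equal to 8n³. The leading term 2048n⁹ comes
-- from the edge list, up to `N * N` edges of `4 * N` bits for their endpoints.
memoryPolynomial : List ℕ
memoryPolynomial = 3 ∷ 1 ∷ 2 ∷ 288 ∷ 8 ∷ 0 ∷ 320 ∷ 384 ∷ 0 ∷ 2048 ∷ []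

memoryBound-polynomial : ∀ n → memoryBound n ≡ eval memoryPolynomial n
memoryBound-polynomial = horner
  where
  -- Both sides are unfolded by hand so that the solver meets only sums and products: `N` is the
  -- computed power, and the final `n * 0` comes from the initial value of `foldr` in `eval`.
  horner : ∀ n →
    let N = n * 2 * (n * 2 * (n * 2 * 1)) in
    (1 + n * (1 + 2 * n)) +
      (((1 + 2 * N) + (1 + N * N * (1 + (2 * N + 2 * N)))) +
        N * (n * 1 + ((1 + N * (1 + 3 * (2 * n + 1))) + (1 + 8 * (1 + 3)))))
    ≡ 3 + n * (1 + n * (2 + n * (288 + n * (8 + n * (0 + n * (320 +
        n * (384 + n * (0 + n * (2048 + n * 0)))))))))
  horner = solve-∀

theorem9 : ∃ λ (p : List ℕ) →
    ∀ (n : ℕ) (E : Instance n) (M : Memory n) (c : Control (instanceGraph M)) →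
    Star _⟶_ (start E) (M , c) → bits M ≤ eval p n
theorem9 = memoryPolynomial , λ n E M c run →
  ≤-trans (bits≤memoryBound M (⟶*-small run (initial-small E)))
    (≤-reflexive (memoryBound-polynomial n))
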